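{- Let $F=\langle\mathcal{A},\mathcal{R}\rangle$ be a finite argumentation framework. Let $F_{\mathrm{IRR}}=\langle\mathrm{IRR}(F),\mathcal{R}_{\mathrm{IRR}}\rangle$ be the argumentation framework whose arguments are the irreducible self-defending sets of $F$ and where $$\mathcal{R}_{\mathrm{IRR}}=\{(S_1,S_2)\mid S_1,S_2\in\mathrm{IRR}(F)\text{ and } S_1\cup S_2\notin\mathrm{ADM}(F)\}.$$ Then $$\mathrm{PREF}(F)=\left\{\bigcup\mathcal{I}\ \middle|\ \mathcal{I}\in\mathrm{NAIV}(F_{\mathrm{IRR}})\right\},$$ and moreover the map $\mathcal{I}\mapsto\bigcup\mathcal{I}$ is a bijection between $\mathrm{NAIV}(F_{\mathrm{IRR}})$ and $\mathrm{PREF}(F)$.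
   Context: All objects are finite. An argumentation framework is a pair $F=\langle \mathcal{A},\mathcal{R}\rangle$ where $\mathcal{A}$ is a finite set (of arguments) and $\mathcal{R}\subseteq\mathcal{A}\times\mathcal{A}$ (attacks; self-attacks are allowed). For $S\subseteq\mathcal{A}$: $S^+=\{x\in\mathcal{A}\mid \exists y\in S,\ (y,x)\in\mathcal{R}\}$ and $S^-=\{x\in\mathcal{A}\mid \exists y\in S,\ (x,y)\in\mathcal{R}\}$. A set $S\subseteq\mathcal{A}$ is conflict-free if $S\cap S^+=\emptyset$; naive sets are the inclusion-wise maximal conflict-free sets, forming the family $\mathrm{NAIV}(F)$. $S$ is self-defending if $S^-\subseteq S^+$; $\mathrm{SD}(F)$ is the family of self-defending sets. $S$ is admissible if it is conflict-free and self-defending; $\mathrm{ADM}(F)$ is the family of admissible sets. Preferred extensions are the inclusion-wise maximal admissible sets, forming the family $\mathrm{PREF}(F)$. A self-defending set $S\in\mathrm{SD}(F)$ with $S\neq\emptyset$ is irreducible if for all $S_1,S_2\in\mathrm{SD}(F)$, $S=S_1\cup S_2$ implies $S=S_1$ or $S=S_2$. $\mathrm{IRR}(F)$ denotes the family of irreducible self-defending sets of $F$. -}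

module Defs where

open import Data.Fin.Base using (Fin; zero)
open import Data.Fin.Properties using (any?; +↔⊎; 0↔⊥; 1↔⊤)
open import Data.Fin.Subset as Sub using (Subset; inside; outside; _∩_; _∪_; _⊆_)
open import Data.Fin.Subset.Properties as Subₚ using (anySubset?; _⊆?_)
open import Data.Irrelevant using ([_])
open import Data.Nat.Base using (ℕ; zero; suc; _+_)
open import Data.Product.Base using (Σ-syntax; ∃; ∃-syntax; _×_; _,_; proj₁; proj₂)
open import Data.Refinement using (Refinement; Refinement-syntax; value; _,_)
open import Data.Sum.Base using (_⊎_; inj₁; inj₂)
open import Data.Sum.Function.Propositional using (_⊎-↔_)
open import Data.Vec.Base using ([]; _∷_; tabulate)
open import Data.Vec.Properties using (≡-dec)
open import Data.Bool.Properties using () renaming (_≟_ to _≟ᵇ_)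
open import Function.Base using (_∘_)
open import Function.Bundles using (_↔_; Inverse; mk↔ₛ′)
open import Function.Construct.Composition using (_↔-∘_)
open import Function.Construct.Symmetry using (↔-sym)
open import Level using (0ℓ)
open import Relation.Binary.Core using (Rel)
open import Relation.Binary.Definitions using () renaming (Decidable to Decidable₂)
open import Relation.Binary.PropositionalEquality
  using (_≡_; _≢_; refl; sym; subst)
open import Relation.Nullary
  using (¬_; Dec; yes; no; does; ¬?; contradiction; _×-dec_; _⊎-dec_; _→-dec_)
open import Relation.Nullary.Decidable using (map′; decidable-stable; recompute)
open import Relation.Unary using (Pred; Decidable)

-- Finiteness of the set of arguments is witnessed by an enumeration, and the
-- classical reading of the attack relation by its decidability.

record AF : Set₁ where
  field
    Arg       : Set
    size      : ℕ
    finite    : Arg ↔ Fin size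
    _attacks_ : Rel Arg 0ℓ
    attacks?  : Decidable₂ _attacks_

  -- Sets of arguments are bit vectors along the enumeration, so that equality
  -- of sets is _≡_ and _∩_, _∪_, _⊆_ are those of Data.Fin.Subset.

  Args : Set
  Args = Subset size

  Family : Set₁
  Family = Pred Args 0ℓ

  infix 4 _∈_ _∈?_

  _∈_ : Arg → Args → Set
  x ∈ S = Inverse.to finite x Sub.∈ S

  _∈?_ : Decidable₂ _∈_
  x ∈? S = Inverse.to finite x Subₚ.∈? S

  anyArg? : {P : Pred Arg 0ℓ} → Decidable P → Dec (∃ P)
  anyArg? {P} P? = map′
    (λ (i , p) → Inverse.from finite i , p)
    (λ (x , p) → Inverse.to finite x
               , subst P (sym (Inverse.strictlyInverseʳ finite x)) p)
    (any? (P? ∘ Inverse.from finite))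

  -- { x | P x }
  comprehension : (P : Pred Arg 0ℓ) → Decidable P → Args
  comprehension P P? = tabulate (does ∘ P? ∘ Inverse.from finite)

Maximal : ∀ {n} → Pred (Subset n) 0ℓ → Pred (Subset n) 0ℓ
Maximal P S = P S × (∀ T → P T → S ⊆ T → S ≡ T)

module _ (F : AF) where

  open AF F

  infix 8 _⁺ _⁻

  _⁺ : Args → Args
  S ⁺ = comprehension (λ x → ∃[ y ] (y ∈ S × y attacks x))
          (λ x → anyArg? (λ y → (y ∈? S) ×-dec attacks? y x))

  _⁻ : Args → Args
  S ⁻ = comprehension (λ x → ∃[ y ] (y ∈ S × x attacks y))
          (λ x → anyArg? (λ y → (y ∈? S) ×-dec attacks? x y))

  ConflictFree : Family
  ConflictFree S = S ∩ S ⁺ ≡ Sub.⊥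

  NAIV : Family
  NAIV = Maximal ConflictFree

  SD : Family
  SD S = S ⁻ ⊆ S ⁺

  ADM : Family
  ADM S = ConflictFree S × SD S

  PREF : Family
  PREF = Maximal ADM

  IRR : Family
  IRR S = SD S × S ≢ Sub.⊥ ×
    (∀ S₁ S₂ → SD S₁ → SD S₂ → S ≡ S₁ ∪ S₂ → S ≡ S₁ ⊎ S ≡ S₂)

infix 4 _≟_

_≟_ : ∀ {n} → Decidable₂ (_≡_ {A = Subset n})
_≟_ = ≡-dec _≟ᵇ_

allSubset? : ∀ {n} {P : Pred (Subset n) 0ℓ} → Decidable P → Dec (∀ S → P S)
allSubset? P? = map′
  (λ ∄ S → decidable-stable (P? S) (λ ¬p → ∄ (S , ¬p)))
  (λ ∀P (S , ¬p) → ¬p (∀P S))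
  (¬? (anySubset? (¬? ∘ P?)))

module _ (F : AF) where

  SD? : Decidable (SD F)
  SD? S = _ ⊆? _

  ADM? : Decidable (ADM F)
  ADM? S = (_ ≟ _) ×-dec SD? S

  IRR? : Decidable (IRR F)
  IRR? S = SD? S ×-dec ¬? (S ≟ Sub.⊥) ×-dec
    allSubset? (λ S₁ → allSubset? (λ S₂ →
      SD? S₁ →-dec (SD? S₂ →-dec
        ((S ≟ S₁ ∪ S₂) →-dec ((S ≟ S₁) ⊎-dec (S ≟ S₂))))))

refinement-finite : ∀ {n} {P : Pred (Subset n) 0ℓ} → Decidable P →
                    Σ[ m ∈ ℕ ] ([ S ∈ Subset n ∣ P S ] ↔ Fin m)
refinement-finite {zero} {P} P? with P? []
... | yes p = 1 , mk↔ₛ′ (λ _ → zero) (λ _ → [] , [ p ])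
                    (λ { zero → refl }) (λ { ([] , _) → refl })
... | no ¬p = 0 , mk↔ₛ′
                    (λ { ([] , [ p ]) → contradiction (recompute (P? []) p) ¬p })
                    (λ ()) (λ ())
                    (λ { ([] , [ p ]) → contradiction (recompute (P? []) p) ¬p })
refinement-finite {suc n} {P} P? =
  let k , f = refinement-finite (P? ∘ (inside ∷_))
      l , g = refinement-finite (P? ∘ (outside ∷_))
  in k + l , ↔-sym +↔⊎ ↔-∘ ((f ⊎-↔ g) ↔-∘ split)
  where
  Side : Sub.Side → Set
  Side s = [ S ∈ Subset n ∣ P (s ∷ S) ]

  split : [ S ∈ Subset (suc n) ∣ P S ] ↔ (Side inside ⊎ Side outside)
  split = mk↔ₛ′
    (λ { (inside ∷ S , p) → inj₁ (S , p) ; (outside ∷ S , p) → inj₂ (S , p) })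
    (λ { (inj₁ (S , p)) → inside ∷ S , p ; (inj₂ (S , p)) → outside ∷ S , p })
    (λ { (inj₁ _) → refl ; (inj₂ _) → refl })
    (λ { (inside ∷ _ , _) → refl ; (outside ∷ _ , _) → refl })

-- The arguments are the irreducible self-defending sets themselves; the
-- refinement type makes two of them equal as soon as they are equal as sets.

F-IRR : AF → AF
F-IRR F = record
  { Arg       = [ S ∈ AF.Args F ∣ IRR F S ]
  ; size      = proj₁ (refinement-finite (IRR? F))
  ; finite    = proj₂ (refinement-finite (IRR? F))
  ; _attacks_ = λ S₁ S₂ → ¬ ADM F (value S₁ ∪ value S₂)
  ; attacks?  = λ S₁ S₂ → ¬? (ADM? F (value S₁ ∪ value S₂))
  }

module _ (F : AF) where

  open AF F
  private module G = AF (F-IRR F)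

  ⋃ : G.Args → Args
  ⋃ 𝓘 = comprehension (λ x → ∃[ S ] (S G.∈ 𝓘 × x ∈ value S))
          (λ x → G.anyArg? (λ S → (S G.∈? 𝓘) ×-dec (x ∈? value S)))

{-# OPTIONS --safe #-}
-- The proof is the adjunction between P ↦ { S ∈ IRR(F) | S ⊆ P } and 𝓘 ↦ ⋃ 𝓘.
-- A minimal self-defending set around a given argument is irreducible, so an
-- admissible P is the union of the irreducible sets below it. Being conflict-free
-- only involves pairs of arguments, so ⋃ 𝓘 is admissible as soon as the members
-- of 𝓘 are pairwise compatible. Both maps are monotone and exchange admissible
-- sets with conflict-free families, hence also their maximal elements.
module Submission where

open import Defs
open import Data.Bool.Base using (true)
open import Data.Fin.Subset as Sub using (Subset; _∪_; _⊆_; _⊂_)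
open import Data.Fin.Subset.Induction using (⊂-wellFounded)
open import Data.Fin.Subset.Properties as Subₚ
  using (anySubset?; _⊆?_; _⊂?_; ⊆-refl; ⊆-trans; ⊆-antisym; p⊆p∪q; q⊆p∪q;
         x∈p∪q⁻; x∈p∩q⁺; x∈p∩q⁻; ∉⊥; ⊆-min)
open import Data.Irrelevant using ([_])
open import Data.Product using (Σ-syntax; ∃; ∃-syntax; _×_; _,_; proj₁; proj₂; -,_)
open import Data.Refinement using (value; _,_)
open import Data.Sum using (_⊎_; inj₁; inj₂; [_,_]′)
open import Data.Vec.Properties using (lookup∘tabulate; []=⇒lookup; lookup⇒[]=)
open import Function.Base using (_on_; _∘_)
open import Function.Bundles using (Inverse)
open import Function.Definitions using (Bijective)
open import Induction.WellFounded using (Acc; acc)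
open import Level using (0ℓ)
open import Relation.Binary.PropositionalEquality
  using (_≡_; refl; sym; trans; cong; subst)
open import Relation.Nullary using (¬_; Dec; does; yes; no; contradiction; _×-dec_)
open import Relation.Nullary.Decidable using (dec-true; decidable-stable; recompute)
open import Relation.Unary using (Pred; Decidable; _≐_)

-- Descent along `⊂`: as long as some proper subset satisfies `Q`, pass to it; well-foundedness ends
-- the search.
minimal-below : ∀ {n} {Q : Pred (Subset n) 0ℓ} → Decidable Q → ∀ P → Q P →
                ∃[ S ] (S ⊆ P × Q S × (∀ T → Q T → T ⊆ S → S ⊆ T))
minimal-below {Q = Q} Q? P = go P (⊂-wellFounded P)
  where
  go : ∀ P → Acc _⊂_ P → Q P →
       ∃[ S ] (S ⊆ P × Q S × (∀ T → Q T → T ⊆ S → S ⊆ T))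
  go P (acc rec) q with anySubset? (λ T → (T ⊂? P) ×-dec Q? T)
  ... | yes (T , T⊂P , qT) =
    let S , S⊆T , rest = go T (rec T⊂P) qT in S , ⊆-trans S⊆T (proj₁ T⊂P) , rest
  -- An element of `P` missing from `T` would make `T` a proper subset satisfying `Q`, which is
  -- excluded.
  ... | no ∄T = P , ⊆-refl , q , λ T qT T⊆P {i} i∈P →
    decidable-stable (i Subₚ.∈? T)
      (λ i∉T → ∄T (T , (T⊆P , i , i∈P , i∉T) , qT))

module _ (F : AF) where

  open AF F

  ∈-comprehension⁺ : {P : Pred Arg 0ℓ} (P? : Decidable P) → ∀ {x} → P x →
                     x ∈ comprehension P P?
  ∈-comprehension⁺ {P} P? {x} px = lookup⇒[]= (Inverse.to finite x) _ (trans
    (lookup∘tabulate (does ∘ P? ∘ Inverse.from finite) (Inverse.to finite x))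
    (dec-true (P? _) (subst P (sym (Inverse.strictlyInverseʳ finite x)) px)))

  ∈-comprehension⁻ : {P : Pred Arg 0ℓ} (P? : Decidable P) → ∀ {x} →
                     x ∈ comprehension P P? → P x
  ∈-comprehension⁻ {P} P? {x} x∈ =
    subst P (Inverse.strictlyInverseʳ finite x)
      (does-≡-true (P? _) (trans
        (sym (lookup∘tabulate (does ∘ P? ∘ Inverse.from finite) (Inverse.to finite x)))
        ([]=⇒lookup x∈)))
    where
    does-≡-true : ∀ {A : Set} (a? : Dec A) → does a? ≡ true → A
    does-≡-true (yes a) _ = a

  ∈-⁺⁺ : ∀ {S x y} → y ∈ S → y attacks x → x ∈ _⁺ F S
  ∈-⁺⁺ {S} y∈S yx = ∈-comprehension⁺
    (λ x → anyArg? (λ y → (y ∈? S) ×-dec attacks? y x)) (-, y∈S , yx)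

  ∈-⁺⁻ : ∀ {S x} → x ∈ _⁺ F S → ∃[ y ] (y ∈ S × y attacks x)
  ∈-⁺⁻ {S} = ∈-comprehension⁻ (λ x → anyArg? (λ y → (y ∈? S) ×-dec attacks? y x))

  ∈-⁻⁺ : ∀ {S x y} → y ∈ S → x attacks y → x ∈ _⁻ F S
  ∈-⁻⁺ {S} y∈S xy = ∈-comprehension⁺
    (λ x → anyArg? (λ y → (y ∈? S) ×-dec attacks? x y)) (-, y∈S , xy)

  ∈-⁻⁻ : ∀ {S x} → x ∈ _⁻ F S → ∃[ y ] (y ∈ S × x attacks y)
  ∈-⁻⁻ {S} = ∈-comprehension⁻ (λ x → anyArg? (λ y → (y ∈? S) ×-dec attacks? x y))

  -- `⊆` ranges over indices in `Fin size`; each of them enumerates an argument, so checking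
  -- arguments is enough.
  ⊆-ext : ∀ {S T} → (∀ {x} → x ∈ S → x ∈ T) → S ⊆ T
  ⊆-ext {S} {T} f {i} i∈S = subst (Sub._∈ T) eq (f (subst (Sub._∈ S) (sym eq) i∈S))
    where eq = Inverse.strictlyInverseˡ finite i

  conflictFree⁺ : ∀ {S} → (∀ {x y} → x ∈ S → y ∈ S → ¬ x attacks y) → ConflictFree F S
  conflictFree⁺ {S} ¬att = ⊆-antisym (⊆-ext λ x∈ →
    let x∈S , x∈S⁺ = x∈p∩q⁻ _ _ x∈
        y , y∈S , yx = ∈-⁺⁻ x∈S⁺
    in contradiction yx (¬att y∈S x∈S)) (⊆-min _)

  conflictFree⁻ : ∀ {S} → ConflictFree F S → ∀ {x y} → x ∈ S → y ∈ S → ¬ x attacks y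
  conflictFree⁻ cf {x} {y} x∈S y∈S xy =
    ∉⊥ (subst (y ∈_) cf (x∈p∩q⁺ (y∈S , ∈-⁺⁺ x∈S xy)))

  conflictFree-⊆ : ∀ {S T} → S ⊆ T → ConflictFree F T → ConflictFree F S
  conflictFree-⊆ S⊆T cf =
    conflictFree⁺ λ x∈S y∈S → conflictFree⁻ cf (S⊆T x∈S) (S⊆T y∈S)

  SD⁺ : ∀ {S} → (∀ {x y} → y ∈ S → x attacks y → ∃[ z ] (z ∈ S × z attacks x)) → SD F S
  SD⁺ defend = ⊆-ext λ x∈S⁻ →
    let y , y∈S , xy = ∈-⁻⁻ x∈S⁻
        z , z∈S , zx = defend y∈S xy
    in ∈-⁺⁺ z∈S zx

  SD⁻ : ∀ {S} → SD F S → ∀ {x y} → y ∈ S → x attacks y → ∃[ z ] (z ∈ S × z attacks x)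
  SD⁻ sd y∈S xy = ∈-⁺⁻ (sd (∈-⁻⁺ y∈S xy))

  -- An attack on the union hits one of the two sets, whose own defender also lies in the union.
  SD-∪ : ∀ {S T} → SD F S → SD F T → SD F (S ∪ T)
  SD-∪ {S} {T} sdS sdT = SD⁺ λ y∈ xy → [
      (λ y∈S → let z , z∈S , zx = SD⁻ sdS y∈S xy in z , p⊆p∪q T z∈S , zx) ,
      (λ y∈T → let z , z∈T , zx = SD⁻ sdT y∈T xy in z , q⊆p∪q S T z∈T , zx)
    ]′ (x∈p∪q⁻ S T y∈)

  -- The witness is minimal among the self-defending subsets of `P` that contain `x`.
  irreducible-below : ∀ {P x} → SD F P → x ∈ P → ∃[ S ] (IRR F S × S ⊆ P × x ∈ S)
  irreducible-below {P} {x} sd x∈P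
    with minimal-below (λ S → SD? F S ×-dec (x ∈? S)) P (sd , x∈P)
  ... | S , S⊆P , (sdS , x∈S) , min = S , (sdS , S≢⊥ , irr) , S⊆P , x∈S
    where
    S≢⊥ : ¬ S ≡ Sub.⊥
    S≢⊥ S≡⊥ = ∉⊥ (subst (x ∈_) S≡⊥ x∈S)

    equal : ∀ {T} → SD F T → x ∈ T → T ⊆ S → S ≡ T
    equal sdT x∈T T⊆S = ⊆-antisym (min _ (sdT , x∈T) T⊆S) T⊆S

    irr : ∀ S₁ S₂ → SD F S₁ → SD F S₂ → S ≡ S₁ ∪ S₂ → S ≡ S₁ ⊎ S ≡ S₂
    -- The part containing `x` competes in the minimality of `S`, so it is all of `S`.
    irr S₁ S₂ sd₁ sd₂ refl with x∈p∪q⁻ S₁ S₂ x∈S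
    ... | inj₁ x∈S₁ = inj₁ (equal sd₁ x∈S₁ (p⊆p∪q S₂))
    ... | inj₂ x∈S₂ = inj₂ (equal sd₂ x∈S₂ (q⊆p∪q S₁ S₂))

module _ (F : AF) where

  open AF F
  private module G = AF (F-IRR F)

  -- The proof stored in a refinement is irrelevant; deciding `IRR` recovers a usable one.
  irreducible : (S : G.Arg) → IRR F (value S)
  irreducible (S , [ p ]) = recompute (IRR? F S) p

  ∈-⋃⁺ : ∀ 𝓘 S {x} → S G.∈ 𝓘 → x ∈ value S → x ∈ ⋃ F 𝓘
  ∈-⋃⁺ 𝓘 S S∈𝓘 x∈S = ∈-comprehension⁺ F
    (λ x → G.anyArg? (λ S → (S G.∈? 𝓘) ×-dec (x ∈? value S))) (S , S∈𝓘 , x∈S)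

  ∈-⋃⁻ : ∀ 𝓘 {x} → x ∈ ⋃ F 𝓘 → ∃[ S ] (S G.∈ 𝓘 × x ∈ value S)
  ∈-⋃⁻ 𝓘 = ∈-comprehension⁻ F
    (λ x → G.anyArg? (λ S → (S G.∈? 𝓘) ×-dec (x ∈? value S)))

  ⊆-⋃ : ∀ 𝓘 S → S G.∈ 𝓘 → value S ⊆ ⋃ F 𝓘
  ⊆-⋃ 𝓘 S S∈𝓘 = ⊆-ext F (∈-⋃⁺ 𝓘 S S∈𝓘)

  ⋃-mono : ∀ 𝓘 𝓙 → 𝓘 ⊆ 𝓙 → ⋃ F 𝓘 ⊆ ⋃ F 𝓙
  ⋃-mono 𝓘 𝓙 𝓘⊆𝓙 = ⊆-ext F λ x∈ →
    let S , S∈𝓘 , x∈S = ∈-⋃⁻ 𝓘 x∈ in ∈-⋃⁺ 𝓙 S (𝓘⊆𝓙 S∈𝓘) x∈S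

  irreducibles : Args → G.Args
  irreducibles P = G.comprehension (λ S → value S ⊆ P) (λ S → value S ⊆? P)

  ∈-irreducibles⁺ : ∀ P S → value S ⊆ P → S G.∈ irreducibles P
  ∈-irreducibles⁺ P S = ∈-comprehension⁺ (F-IRR F) (λ S → value S ⊆? P) {S}

  ∈-irreducibles⁻ : ∀ P S → S G.∈ irreducibles P → value S ⊆ P
  ∈-irreducibles⁻ P S = ∈-comprehension⁻ (F-IRR F) (λ S → value S ⊆? P) {S}

  -- The direction of the adjunction that maximality arguments use: each member of `𝓘` lies below
  -- the union, hence below `P`.
  ⊆-irreducibles : ∀ 𝓘 P → ⋃ F 𝓘 ⊆ P → 𝓘 ⊆ irreducibles P
  ⊆-irreducibles 𝓘 P ⋃𝓘⊆P = ⊆-ext (F-IRR F) {𝓘} {irreducibles P} λ {S} S∈𝓘 →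
    ∈-irreducibles⁺ P S (⊆-trans (⊆-⋃ 𝓘 S S∈𝓘) ⋃𝓘⊆P)

  ⋃-irreducibles : ∀ P → SD F P → ⋃ F (irreducibles P) ≡ P
  ⋃-irreducibles P sd = ⊆-antisym
    (⊆-ext F λ x∈ → let S , S∈ , x∈S = ∈-⋃⁻ (irreducibles P) x∈
                    in ∈-irreducibles⁻ P S S∈ x∈S)
    (⊆-ext F λ x∈P → let S , irr , S⊆P , x∈S = irreducible-below F sd x∈P
                         S′ = S , [ irr ]
                     in ∈-⋃⁺ (irreducibles P) S′ (∈-irreducibles⁺ P S′ S⊆P) x∈S)

  ⋃-ADM : ∀ 𝓘 → ConflictFree (F-IRR F) 𝓘 → ADM F (⋃ F 𝓘)
  ⋃-ADM 𝓘 cf = conflictFree⁺ F compatible , SD⁺ F defend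
    where
    compatible : ∀ {x y} → x ∈ ⋃ F 𝓘 → y ∈ ⋃ F 𝓘 → ¬ x attacks y
    compatible x∈ y∈ =
      let S , S∈𝓘 , x∈S = ∈-⋃⁻ 𝓘 x∈
          T , T∈𝓘 , y∈T = ∈-⋃⁻ 𝓘 y∈
          -- Absence of an attack is a doubly negated admissibility of the union, removed by
          -- decidability; `S` and `T` may coincide.
          cf∪ , _ = decidable-stable (ADM? F (value S ∪ value T))
                      (conflictFree⁻ (F-IRR F) {𝓘} cf {S} {T} S∈𝓘 T∈𝓘)
      in conflictFree⁻ F cf∪ (p⊆p∪q (value T) x∈S) (q⊆p∪q (value S) (value T) y∈T)

    defend : ∀ {x y} → y ∈ ⋃ F 𝓘 → x attacks y → ∃[ z ] (z ∈ ⋃ F 𝓘 × z attacks x)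
    defend y∈ xy =
      let S , S∈𝓘 , y∈S = ∈-⋃⁻ 𝓘 y∈
          z , z∈S , zx = SD⁻ F (proj₁ (irreducible S)) y∈S xy
      in z , ∈-⋃⁺ 𝓘 S S∈𝓘 z∈S , zx

  -- Two irreducible sets below `P` have a union below `P`, which inherits conflict-freeness and is
  -- self-defending by `SD-∪`.
  irreducibles-conflictFree : ∀ P → ConflictFree F P →
                              ConflictFree (F-IRR F) (irreducibles P)
  irreducibles-conflictFree P cf =
    conflictFree⁺ (F-IRR F) {irreducibles P} λ {S} {T} S∈ T∈ ¬adm → ¬adm
      ( conflictFree-⊆ F
          ([ ∈-irreducibles⁻ P S S∈ , ∈-irreducibles⁻ P T T∈ ]′
            ∘ x∈p∪q⁻ (value S) (value T)) cf
      , SD-∪ F (proj₁ (irreducible S)) (proj₁ (irreducible T)) )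

  -- For an admissible `T` above `⋃ F 𝓘`, the family `irreducibles T` is conflict-free and contains
  -- `𝓘`, so it equals `𝓘`; taking unions gives back `T`.
  NAIV⇒PREF : ∀ 𝓘 → NAIV (F-IRR F) 𝓘 → PREF F (⋃ F 𝓘)
  NAIV⇒PREF 𝓘 (cf , max) = ⋃-ADM 𝓘 cf , λ T (cfT , sdT) ⋃𝓘⊆T →
    trans (cong (⋃ F) (max (irreducibles T) (irreducibles-conflictFree T cfT)
                           (⊆-irreducibles 𝓘 T ⋃𝓘⊆T)))
          (⋃-irreducibles T sdT)

  PREF⇒NAIV : ∀ P → PREF F P → NAIV (F-IRR F) (irreducibles P)
  PREF⇒NAIV P ((cf , sd) , max) = irreducibles-conflictFree P cf , λ 𝓙 cf𝓙 I⊆𝓙 →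
    let P⊆⋃𝓙 = subst (_⊆ ⋃ F 𝓙) (⋃-irreducibles P sd) (⋃-mono (irreducibles P) 𝓙 I⊆𝓙)
        P≡⋃𝓙 = max (⋃ F 𝓙) (⋃-ADM 𝓙 cf𝓙) P⊆⋃𝓙
    -- Since `⋃ F 𝓙` is `P` itself, every member of `𝓙` lies below `P`.
    in ⊆-antisym I⊆𝓙 (⊆-irreducibles 𝓙 P (subst (⋃ F 𝓙 ⊆_) (sym P≡⋃𝓙) ⊆-refl))

  -- Maximality forces a naive family to contain every irreducible set below its union; injectivity
  -- follows, as the union determines the family.
  irreducibles-⋃ : ∀ 𝓘 → NAIV (F-IRR F) 𝓘 → 𝓘 ≡ irreducibles (⋃ F 𝓘)
  irreducibles-⋃ 𝓘 (cf , max) =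
    max (irreducibles (⋃ F 𝓘)) (irreducibles-conflictFree (⋃ F 𝓘) (proj₁ (⋃-ADM 𝓘 cf)))
        (⊆-irreducibles 𝓘 (⋃ F 𝓘) ⊆-refl)

lemma4 : (F : AF) →
    (PREF F ≐ (λ P → ∃[ 𝓘 ] (NAIV (F-IRR F) 𝓘 × P ≡ ⋃ F 𝓘))) ×
    (Σ[ ⋃-pref ∈ (∀ 𝓘 → NAIV (F-IRR F) 𝓘 → PREF F (⋃ F 𝓘)) ]
    Bijective {A = ∃ (NAIV (F-IRR F))} {B = ∃ (PREF F)}
    (_≡_ on proj₁) (_≡_ on proj₁)
    (λ (𝓘 , naive) → ⋃ F 𝓘 , ⋃-pref 𝓘 naive))
lemma4 F =
    ( (λ {P} pref → irreducibles F P , PREF⇒NAIV F P pref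
                  , sym (⋃-irreducibles F P (proj₂ (proj₁ pref))))
    , λ { (𝓘 , naive , refl) → NAIV⇒PREF F 𝓘 naive } )
  , NAIV⇒PREF F
  , (λ {(𝓘 , naive𝓘)} {(𝓙 , naive𝓙)} ⋃𝓘≡⋃𝓙 →
      trans (irreducibles-⋃ F 𝓘 naive𝓘)
        (trans (cong (irreducibles F) ⋃𝓘≡⋃𝓙) (sym (irreducibles-⋃ F 𝓙 naive𝓙))))
  -- Surjectivity asks that every family equal to the chosen preimage be sent to `P`, hence the
  -- rewriting along `𝓘≡`.
  , λ (P , pref) → (irreducibles F P , PREF⇒NAIV F P pref) ,
      λ 𝓘≡ → trans (cong (⋃ F) 𝓘≡) (⋃-irreducibles F P (proj₂ (proj₁ pref)))
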